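{- Let $N=\{1,2,\ldots,n\}$. (1) For every $\mathrm{L}_2$-convex set $S\subseteq\mathbb{Z}^n$ there exist $\gamma_{IJ}\in\mathbb{Z}\cup\{+\infty\}$, indexed by the pairs $(I,J)$ of subsets of $N$ with $|I|=|J|$ and $I\cap J=\emptyset$, such that $$S=\{x\in\mathbb{Z}^n \mid x(J)-x(I)\le\gamma_{IJ}\ \text{ for all } (I,J) \text{ with } |I|=|J|,\ I\cap J=\emptyset\}.$$ (2) For every $\mathrm{L}_2$-convex polyhedron $P\subseteq\mathbb{R}^n$ there exist $\gamma_{IJ}\in\mathbb{R}\cup\{+\infty\}$, indexed by the same pairs $(I,J)$, such that $$P=\{x\in\mathbb{R}^n \mid x(J)-x(I)\le\gamma_{IJ}\ \text{ for all } (I,J) \text{ with } |I|=|J|,\ I\cap J=\emptyset\}.$$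
   Context: For a vector $x=(x_1,\ldots,x_n)$ and $I\subseteq N$, $x(I)=\sum_{i\in I}x_i$. The vectors $x\vee y$ and $x\wedge y$ are the componentwise maximum and minimum, and $\mathbf{1}=(1,\ldots,1)$. A nonempty set $S\subseteq\mathbb{Z}^n$ is called L-convex if (i) $x,y\in S$ implies $x\vee y,\ x\wedge y\in S$, and (ii) $x\in S$, $\mu\in\mathbb{Z}$ implies $x+\mu\mathbf{1}\in S$. A nonempty polyhedron $P\subseteq\mathbb{R}^n$ is called L-convex if (i) $x,y\in P$ implies $x\vee y,\ x\wedge y\in P$, and (ii) $x\in P$, $\mu\in\mathbb{R}$ implies $x+\mu\mathbf{1}\in P$. A set $S\subseteq\mathbb{Z}^n$ is called $\mathrm{L}_2$-convex if $S=S_1+S_2=\{y+z\mid y\in S_1,\ z\in S_2\}$ for some L-convex sets $S_1,S_2\subseteq\mathbb{Z}^n$. A polyhedron $P\subseteq\mathbb{R}^n$ is called $\mathrm{L}_2$-convex if it is the Minkowski sum $P_1+P_2$ of two L-convex polyhedra $P_1,P_2\subseteq\mathbb{R}^n$. -}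

module Defs where

open import Level using (0ℓ; suc)
open import Algebra.Bundles using (CommutativeRing)
open import Algebra.Construct.NaturalChoice.Max as NaturalMax using ()
open import Algebra.Construct.NaturalChoice.Min as NaturalMin using ()
open import Data.Fin.Subset using (Subset; inside; outside; ∣_∣; _∩_; Empty)
open import Data.Integer.Base as ℤ using (ℤ)
open import Data.Nat.Base using (ℕ)
open import Data.Product.Base using (∃; ∃₂; ∃-syntax; _×_)
open import Data.Vec.Base using (Vec; []; _∷_; map; zipWith; replicate; foldr′)
open import Data.Vec.Relation.Binary.Pointwise.Inductive using (Pointwise)
open import Relation.Binary.Bundles using (TotalOrder)
open import Relation.Binary.Core using (Rel)
import Relation.Binary.Construct.Add.Supremum.NonStrict as AddSupremum
open import Relation.Binary.PropositionalEquality.Core using (_≡_)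
open import Relation.Binary.Structures using (IsTotalOrder)
open import Relation.Nullary.Construct.Add.Supremum using (_⁺; [_])
open import Relation.Nullary.Negation.Core using (¬_)
open import Relation.Unary using (Pred; Satisfiable; _≐_)

-- The real numbers, given by their axiomatic characterisation (unique up to
-- isomorphism): a Dedekind-complete totally ordered field.  Equality is a
-- setoid equality, so that quotient constructions of ℝ are instances.

record CompleteOrderedField : Set (suc 0ℓ) where
  field
    commutativeRing : CommutativeRing 0ℓ 0ℓ

  open CommutativeRing commutativeRing public

  infix 4 _≤_

  field
    _≤_          : Rel Carrier 0ℓ
    isTotalOrder : IsTotalOrder _≈_ _≤_
    0≉1          : ¬ (0# ≈ 1#)
    inverse      : ∀ x → ¬ (x ≈ 0#) → ∃[ y ] x * y ≈ 1#
    +-monoˡ-≤    : ∀ z {x y} → x ≤ y → x + z ≤ y + z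
    *-nonNeg     : ∀ {x y} → 0# ≤ x → 0# ≤ y → 0# ≤ x * y

  IsUpperBound : Pred Carrier 0ℓ → Pred Carrier 0ℓ
  IsUpperBound A b = ∀ x → A x → x ≤ b

  field
    supremum : ∀ (A : Pred Carrier 0ℓ) → Satisfiable A → Satisfiable (IsUpperBound A) →
               ∃[ s ] (IsUpperBound A s × (∀ b → IsUpperBound A b → s ≤ b))

  totalOrder : TotalOrder 0ℓ 0ℓ 0ℓ
  totalOrder = record { isTotalOrder = isTotalOrder }

  open NaturalMax totalOrder public using (_⊔_)
  open NaturalMin totalOrder public using (_⊓_)

-- The operations of a scalar domain.  It carries no laws: it only lets the
-- definitions common to ℤⁿ and ℝⁿ be written once, and is instantiated below
-- at ℤ and at the reals alone.

record Scalars : Set (suc 0ℓ) where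
  infix  4 _≈_ _≤_
  infixl 6 _+_ _-_ _⊔_ _⊓_
  field
    Carrier         : Set
    _≈_ _≤_         : Rel Carrier 0ℓ
    0#              : Carrier
    _+_ _-_ _⊔_ _⊓_ : Carrier → Carrier → Carrier

ℤ-scalars : Scalars
ℤ-scalars = record
  { Carrier = ℤ ; _≈_ = _≡_ ; _≤_ = ℤ._≤_ ; 0# = ℤ.0ℤ
  ; _+_ = ℤ._+_ ; _-_ = ℤ._-_ ; _⊔_ = ℤ._⊔_ ; _⊓_ = ℤ._⊓_ }

field-scalars : CompleteOrderedField → Scalars
field-scalars ℝ = record
  { Carrier = Carrier ; _≈_ = _≈_ ; _≤_ = _≤_ ; 0# = 0#
  ; _+_ = _+_ ; _-_ = _-_ ; _⊔_ = _⊔_ ; _⊓_ = _⊓_ }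
  where open CompleteOrderedField ℝ

module Vectors (K : Scalars) where
  open Scalars K

  -- x ⟨ I ⟩ is x(I), the sum of the components of x with index in I.

  infix 9 _⟨_⟩

  _⟨_⟩ : ∀ {n} → Vec Carrier n → Subset n → Carrier
  []      ⟨ [] ⟩          = 0#
  (a ∷ x) ⟨ inside  ∷ I ⟩ = a + x ⟨ I ⟩
  (a ∷ x) ⟨ outside ∷ I ⟩ = x ⟨ I ⟩

  _∨_ _∧_ : ∀ {n} → Vec Carrier n → Vec Carrier n → Vec Carrier n
  _∨_ = zipWith _⊔_
  _∧_ = zipWith _⊓_

  _+𝟏*_ : ∀ {n} → Vec Carrier n → Carrier → Vec Carrier n
  _+𝟏*_ {n} x μ = zipWith _+_ x (replicate n μ)

  IsLConvex : ∀ {n} → Pred (Vec Carrier n) 0ℓ → Set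
  IsLConvex S =
    Satisfiable S
    × (∀ x y → S x → S y → S (x ∨ y) × S (x ∧ y))
    × (∀ x μ → S x → S (x +𝟏* μ))

  _⊕_ : ∀ {n} → (S T : Pred (Vec Carrier n) 0ℓ) → Pred (Vec Carrier n) 0ℓ
  (S ⊕ T) x = ∃₂ λ y z → S y × T z × Pointwise _≈_ x (zipWith _+_ y z)

  -- The constraints range over the pairs (I , J) with |I| = |J| and I ∩ J = ∅
  -- only; the values of γ at all other pairs are irrelevant.

  Constrained : ∀ {n} → (Subset n → Subset n → Carrier ⁺) → Pred (Vec Carrier n) 0ℓ
  Constrained γ x = ∀ I J → ∣ I ∣ ≡ ∣ J ∣ → Empty (I ∩ J) →
                    [ x ⟨ J ⟩ - x ⟨ I ⟩ ] ≤⁺ γ I J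
    where open AddSupremum _≤_ using (_≤⁺_)

module Integral where
  open Vectors ℤ-scalars public

  IsL₂Convex : ∀ {n} → Pred (Vec ℤ n) 0ℓ → Set (suc 0ℓ)
  IsL₂Convex S = ∃₂ λ S₁ S₂ → IsLConvex S₁ × IsLConvex S₂ × S ≐ (S₁ ⊕ S₂)

module Real (ℝ : CompleteOrderedField) where
  open CompleteOrderedField ℝ using (Carrier; _≤_; _+_; _*_; 0#) public
  open Vectors (field-scalars ℝ) public

  _·_ : ∀ {n} → Vec Carrier n → Vec Carrier n → Carrier
  a · x = foldr′ _+_ 0# (zipWith _*_ a x)

  IsPolyhedron : ∀ {n} → Pred (Vec Carrier n) 0ℓ → Set
  IsPolyhedron {n} P =
    ∃[ m ] ∃₂ λ (A : Vec (Vec Carrier n) m) (b : Vec Carrier m) →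
      P ≐ λ x → Pointwise _≤_ (map (_· x) A) b

  IsLConvexPolyhedron : ∀ {n} → Pred (Vec Carrier n) 0ℓ → Set
  IsLConvexPolyhedron P = IsPolyhedron P × IsLConvex P

  IsL₂ConvexPolyhedron : ∀ {n} → Pred (Vec Carrier n) 0ℓ → Set (suc 0ℓ)
  IsL₂ConvexPolyhedron P =
    IsPolyhedron P
    × ∃₂ λ P₁ P₂ → IsLConvexPolyhedron P₁ × IsLConvexPolyhedron P₂ × P ≐ (P₁ ⊕ P₂)

{-# OPTIONS --safe #-}
module Submission where

-- ℤ and ℝ are treated together as complete totally ordered abelian groups, and
-- γ I J is the supremum of s(J) − s(I) over S.  A closed L-convex set consists of
-- all p whose differences p(v) − p(u) stay below every bound of q(v) − q(u) on
-- the set: joins, then meets, of suitably shifted members approximate such a p.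
-- Hence x ∈ S₁ + S₂ iff some y meets the difference bounds of S₁ and those of
-- x − S₂.  Reading these bounds as arcs of a weighted graph, such a y is a
-- shortest-path potential, which exists once no simple cycle is negative.  On a
-- simple cycle, let J be the vertices where it switches from arcs of S₁ to arcs
-- of x − S₂, and I those where it switches back.  Then |I| = |J|, I ∩ J = ∅, and
-- the arc bounds telescope to the inequality for (I , J).

open import Defs
open import Level using (0ℓ)
open import Algebra.Bundles using (AbelianGroup)
open import Algebra.Structures using (IsAbelianGroup)
open import Axiom.ExcludedMiddle using (ExcludedMiddle)
open import Data.Bool.Base using (Bool; true; false; if_then_else_; not)
open import Data.Fin.Base using (Fin; zero; suc)
open import Data.Fin.Properties using (_≟_)
open import Data.Fin.Subset
  using (Subset; inside; outside; ∣_∣; _∩_; _∪_; ⁅_⁆; ⊥; _∈_; _∉_; _⊆_; Empty)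
open import Data.Fin.Subset.Properties
  using (_∈?_; ∉⊥; ∪-identityʳ; x∈p∪q⁻; p⊆p∪q; q⊆p∪q; x∈⁅x⁆; x∈⁅y⁆⇒x≡y; x∈p∩q⁻; ∣p∣≤n)
open import Data.Integer.Base as ℤ using (ℤ)
import Data.Integer.Properties as ℤ
open import Data.Nat.Base as ℕ using (ℕ; zero; suc)
open import Data.Product.Base using (∃; ∃₂; ∃-syntax; _×_; _,_; proj₁; proj₂)
open import Data.Sum.Base using (_⊎_; inj₁; inj₂; [_,_]′)
open import Data.Vec.Base using (Vec; []; _∷_; lookup; map; zipWith; replicate; tabulate; here; there)
open import Data.Vec.N-ary using (N-ary; curryⁿ; Eqʰ; Eq-to-Eqʰ; curryⁿ-cong)
open import Data.Vec.Properties using (lookup-zipWith; lookup-replicate; lookup∘tabulate; tabulate∘lookup; tabulate-cong)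
open import Data.Vec.Relation.Binary.Pointwise.Inductive as Pointwise using (Pointwise; []; _∷_)
open import Function.Base using (_∘_; case_of_)
open import Relation.Binary.PropositionalEquality as ≡ using (_≡_)
open import Relation.Binary.Structures using (IsTotalOrder)
open import Relation.Nullary.Construct.Add.Supremum using (_⁺; [_]; ⊤⁺)
open import Relation.Nullary.Decidable.Core using (True; toWitness; yes; no)
open import Relation.Nullary.Negation.Core using (¬_; contradiction)
open import Relation.Unary using (Pred; Satisfiable; _≐_)
import Algebra.Construct.NaturalChoice.Max as MaxProperties
import Algebra.Construct.NaturalChoice.Min as MinProperties
import Algebra.Properties.Ring
import Algebra.Properties.AbelianGroup
import Algebra.Properties.CommutativeSemigroup
import Algebra.Solver.CommutativeMonoid
import Algebra.Solver.CommutativeMonoid.Normal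
import Relation.Binary.Reasoning.Setoid
import Relation.Binary.Reflection
import Relation.Binary.Construct.Add.Supremum.NonStrict as AddSupremum

-- Complete totally ordered abelian groups.

record IsCompleteOrderedGroup (K : Scalars) : Set₁ where
  open Scalars K
  field
    negate         : Carrier → Carrier
    isAbelianGroup : IsAbelianGroup _≈_ _+_ 0# negate
    x-y≈x+-y       : ∀ x y → x - y ≈ x + negate y
    isTotalOrder   : IsTotalOrder _≈_ _≤_
    +-monoˡ-≤      : ∀ z {x y} → x ≤ y → x + z ≤ y + z
    x≤x⊔y          : ∀ x y → x ≤ x ⊔ y
    y≤x⊔y          : ∀ x y → y ≤ x ⊔ y
    ⊔-lub          : ∀ {x y z} → x ≤ z → y ≤ z → x ⊔ y ≤ z
    x⊓y≤x          : ∀ x y → x ⊓ y ≤ x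
    x⊓y≤y          : ∀ x y → x ⊓ y ≤ y
    ⊓-glb          : ∀ {x y z} → z ≤ x → z ≤ y → z ≤ x ⊓ y
    supremum       : (A : Pred Carrier 0ℓ) → Satisfiable A →
                     ∃[ b ] (∀ x → A x → x ≤ b) →
                     ∃[ s ] ((∀ x → A x → x ≤ s) × (∀ b → (∀ x → A x → x ≤ b) → s ≤ b))

  abelianGroup : AbelianGroup 0ℓ 0ℓ
  abelianGroup = record { isAbelianGroup = isAbelianGroup }

  open AbelianGroup abelianGroup public
    using (setoid; commutativeMonoid; commutativeSemigroup)
    renaming ( refl to ≈-refl; sym to ≈-sym; trans to ≈-trans; ∙-cong to +-cong; ∙-congˡ to +-congˡ
             ; ∙-congʳ to +-congʳ; comm to +-comm; assoc to +-assoc; identityˡ to +-identityˡ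
             ; identityʳ to +-identityʳ; inverseˡ to -‿inverseˡ; ⁻¹-cong to -‿cong)

  open IsTotalOrder isTotalOrder public
    using () renaming
      (refl to ≤-refl; reflexive to ≤-reflexive; trans to ≤-trans; total to ≤-total; antisym to ≤-antisym)

-- Deciding identities in abelian groups.

module GroupSolver (K : Scalars) (G : IsCompleteOrderedGroup K) where
  open Scalars K
  open IsCompleteOrderedGroup G
  private
    module M = Algebra.Solver.CommutativeMonoid commutativeMonoid
    module Normal = Algebra.Solver.CommutativeMonoid.Normal commutativeMonoid
  open Algebra.Properties.CommutativeSemigroup commutativeSemigroup using (interchange)
  open Algebra.Properties.AbelianGroup abelianGroup using (∙-cancelʳ)
  open Relation.Binary.Reasoning.Setoid setoid

  infixl 6 _:+_ _:-_
  infix  4 _:≈_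

  -- An equation between group expressions is decided as an identity of
  -- commutative monoids, after moving all subtracted terms to the other side.
  data Expr (n : ℕ) : Set where
    var       : Fin n → Expr n
    :0        : Expr n
    _:+_ _:-_ : Expr n → Expr n → Expr n

  ⟦_⟧ : ∀ {n} → Expr n → Vec Carrier n → Carrier
  ⟦ var i  ⟧ ρ = lookup ρ i
  ⟦ :0     ⟧ ρ = 0#
  ⟦ a :+ b ⟧ ρ = ⟦ a ⟧ ρ + ⟦ b ⟧ ρ
  ⟦ a :- b ⟧ ρ = ⟦ a ⟧ ρ - ⟦ b ⟧ ρ

  pos neg : ∀ {n} → Expr n → M.Expr n
  pos (var i)  = M.var i
  pos :0       = M.id
  pos (a :+ b) = pos a M.⊕ pos b
  pos (a :- b) = pos a M.⊕ neg b
  neg (var i)  = M.id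
  neg :0       = M.id
  neg (a :+ b) = neg a M.⊕ neg b
  neg (a :- b) = neg a M.⊕ pos b

  -+-cancel : ∀ x y → (x - y) + y ≈ x
  -+-cancel x y = begin
    (x - y) + y     ≈⟨ +-congʳ (x-y≈x+-y x y) ⟩
    (x + negate y) + y  ≈⟨ +-assoc x (negate y) y ⟩
    x + (negate y + y)  ≈⟨ +-congˡ (-‿inverseˡ y) ⟩
    x + 0#          ≈⟨ +-identityʳ x ⟩
    x               ∎

  balance : ∀ {n} (e : Expr n) ρ → ⟦ e ⟧ ρ + M.⟦ neg e ⟧ ρ ≈ M.⟦ pos e ⟧ ρ
  balance (var i)  ρ = +-identityʳ _
  balance :0       ρ = +-identityʳ _
  balance (a :+ b) ρ = ≈-trans (interchange _ _ _ _) (+-cong (balance a ρ) (balance b ρ))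
  balance (a :- b) ρ = begin
    -- The induction hypothesis for `b` exposes a copy of `B` that cancels the subtracted one.
    (A - B) + (M.⟦ neg a ⟧ ρ + M.⟦ pos b ⟧ ρ)      ≈⟨ +-congˡ (+-congˡ (balance b ρ)) ⟨
    (A - B) + (M.⟦ neg a ⟧ ρ + (B + M.⟦ neg b ⟧ ρ)) ≈⟨ rearrange (A - B) _ B _ ⟩
    ((A - B) + B + M.⟦ neg a ⟧ ρ) + M.⟦ neg b ⟧ ρ   ≈⟨ +-congʳ (+-congʳ (-+-cancel A B)) ⟩
    (A + M.⟦ neg a ⟧ ρ) + M.⟦ neg b ⟧ ρ             ≈⟨ +-congʳ (balance a ρ) ⟩
    M.⟦ pos a ⟧ ρ + M.⟦ neg b ⟧ ρ                   ∎
    where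
    A = ⟦ a ⟧ ρ
    B = ⟦ b ⟧ ρ
    rearrange : ∀ p q r s → p + (q + (r + s)) ≈ p + r + q + s
    rearrange = M.solve 4 (λ p q r s → p M.⊕ (q M.⊕ (r M.⊕ s)) M.⊜ ((p M.⊕ r) M.⊕ q) M.⊕ s) ≈-refl

  _:≈_ : ∀ {n} → Expr n → Expr n → Expr n × Expr n
  _:≈_ = _,_

  module R = Relation.Binary.Reflection setoid var ⟦_⟧ ⟦_⟧ (λ _ _ → ≈-refl)

  -- For a valid identity this reduces to the unit type, so that `solve` gets its implicit argument
  -- by eta.
  SameBalance : ∀ {n} → Expr n × Expr n → Set
  SameBalance (e₁ , e₂) = True (M.normalise (pos e₁ M.⊕ neg e₂) M.≟ M.normalise (pos e₂ M.⊕ neg e₁))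

  prove : ∀ {n} (e₁ e₂ : Expr n) → SameBalance (e₁ , e₂) → ∀ ρ → ⟦ e₁ ⟧ ρ ≈ ⟦ e₂ ⟧ ρ
  prove e₁ e₂ same ρ = ∙-cancelʳ (M.⟦ neg e₁ ⟧ ρ + M.⟦ neg e₂ ⟧ ρ) _ _ (begin
    ⟦ e₁ ⟧ ρ + (N₁ + N₂)          ≈⟨ +-assoc _ _ _ ⟨
    ⟦ e₁ ⟧ ρ + N₁ + N₂            ≈⟨ +-congʳ (balance e₁ ρ) ⟩
    M.⟦ pos e₁ ⟧ ρ + N₂           ≈⟨ Normal.correct (pos e₁ M.⊕ neg e₂) ρ ⟨
    M.⟦ M.normalise (pos e₁ M.⊕ neg e₂) ⟧⇓ ρ ≡⟨ ≡.cong (λ e → M.⟦ e ⟧⇓ ρ) (toWitness same) ⟩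
    M.⟦ M.normalise (pos e₂ M.⊕ neg e₁) ⟧⇓ ρ ≈⟨ Normal.correct (pos e₂ M.⊕ neg e₁) ρ ⟩
    M.⟦ pos e₂ ⟧ ρ + N₁           ≈⟨ +-congʳ (balance e₂ ρ) ⟨
    ⟦ e₂ ⟧ ρ + N₂ + N₁            ≈⟨ +-assoc _ _ _ ⟩
    ⟦ e₂ ⟧ ρ + (N₂ + N₁)          ≈⟨ +-congˡ (+-comm _ _) ⟩
    ⟦ e₂ ⟧ ρ + (N₁ + N₂)          ∎)
    where
    N₁ = M.⟦ neg e₁ ⟧ ρ
    N₂ = M.⟦ neg e₂ ⟧ ρ

  solve : ∀ n (f : N-ary n (Expr n) (Expr n × Expr n)) {same : SameBalance (R.close n f)} →
          Eqʰ n _≈_ (curryⁿ ⟦ proj₁ (R.close n f) ⟧) (curryⁿ ⟦ proj₂ (R.close n f) ⟧)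
  solve n f {same} = Eq-to-Eqʰ n _≈_ (curryⁿ-cong _≈_ _ _ (prove (proj₁ (R.close n f)) (proj₂ (R.close n f)) same))

-- Order arithmetic and the sums x(I).

module OrderedGroupProperties (K : Scalars) (G : IsCompleteOrderedGroup K) where
  open Scalars K
  open IsCompleteOrderedGroup G
  open GroupSolver K G

  -‿cong₂ : ∀ {a b c d} → a ≈ b → c ≈ d → a - c ≈ b - d
  -‿cong₂ a≈b c≈d = ≈-trans (x-y≈x+-y _ _) (≈-trans (+-cong a≈b (-‿cong c≈d)) (≈-sym (x-y≈x+-y _ _)))

  ≤-respˡ : ∀ {x x′ y} → x ≈ x′ → x ≤ y → x′ ≤ y
  ≤-respˡ x≈x′ = ≤-trans (≤-reflexive (≈-sym x≈x′))

  ≤-respʳ : ∀ {x y y′} → y ≈ y′ → x ≤ y → x ≤ y′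
  ≤-respʳ y≈y′ x≤y = ≤-trans x≤y (≤-reflexive y≈y′)

  +-mono-≤ : ∀ {a b c d} → a ≤ b → c ≤ d → a + c ≤ b + d
  +-mono-≤ {b = b} {c} a≤b c≤d =
    ≤-trans (+-monoˡ-≤ c a≤b) (≤-respˡ (+-comm c b) (≤-respʳ (+-comm _ b) (+-monoˡ-≤ b c≤d)))

  +-cancelʳ-≤ : ∀ {x y} z → x + z ≤ y + z → x ≤ y
  +-cancelʳ-≤ z le =
    ≤-respˡ (solve 2 (λ x z → (x :+ z) :+ (:0 :- z) :≈ x))
      (≤-respʳ (solve 2 (λ y z → (y :+ z) :+ (:0 :- z) :≈ y)) (+-monoˡ-≤ (0# - z) le))

  -- Linear arithmetic in one step: `a ≤ b` is the sum of the hypotheses, and the equation, settled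
  -- by the solver, says that x - y equals a - b.
  ≤-by : ∀ {x y a b} → a ≤ b → x + b ≈ y + a → x ≤ y
  ≤-by {x} {y} {a} {b} a≤b eq = +-cancelʳ-≤ b (≤-respˡ (≈-sym eq) (+-mono-≤ (≤-refl {y}) a≤b))

  infimum : (A : Pred Carrier 0ℓ) → Satisfiable A → ∃[ b ] (∀ x → A x → b ≤ x) →
            ∃[ s ] ((∀ x → A x → s ≤ x) × (∀ b → (∀ x → A x → b ≤ x) → b ≤ s))
  infimum A (a , Aa) lower with supremum (λ b → ∀ x → A x → b ≤ x) lower (a , λ b b≤ → b≤ a Aa)
  ... | s , upper , least = s , (λ x Ax → least x (λ b b≤ → b≤ x Ax)) , upper

  open Vectors K public

  ⟨⟩-+ : ∀ {n} (y z : Vec Carrier n) I → zipWith _+_ y z ⟨ I ⟩ ≈ y ⟨ I ⟩ + z ⟨ I ⟩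
  ⟨⟩-+ []      []      []            = solve 0 (:0 :≈ :0 :+ :0)
  ⟨⟩-+ (a ∷ y) (b ∷ z) (inside  ∷ I) =
    ≈-trans (+-congˡ (⟨⟩-+ y z I)) (solve 4 (λ a b c d → (a :+ b) :+ (c :+ d) :≈ (a :+ c) :+ (b :+ d)))
  ⟨⟩-+ (a ∷ y) (b ∷ z) (outside ∷ I) = ⟨⟩-+ y z I

  ⟨⟩-- : ∀ {n} (y z : Vec Carrier n) I → zipWith _-_ y z ⟨ I ⟩ ≈ y ⟨ I ⟩ - z ⟨ I ⟩
  ⟨⟩-- []      []      []            = solve 0 (:0 :≈ :0 :- :0)
  ⟨⟩-- (a ∷ y) (b ∷ z) (inside  ∷ I) =
    ≈-trans (+-congˡ (⟨⟩-- y z I)) (solve 4 (λ a b c d → (a :- b) :+ (c :- d) :≈ (a :+ c) :- (b :+ d)))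
  ⟨⟩-- (a ∷ y) (b ∷ z) (outside ∷ I) = ⟨⟩-- y z I

  ⟨⟩-cong : ∀ {n} {x y : Vec Carrier n} → Pointwise _≈_ x y → ∀ I → x ⟨ I ⟩ ≈ y ⟨ I ⟩
  ⟨⟩-cong []         []            = ≈-refl
  ⟨⟩-cong (a≈b ∷ eq) (inside  ∷ I) = +-cong a≈b (⟨⟩-cong eq I)
  ⟨⟩-cong (a≈b ∷ eq) (outside ∷ I) = ⟨⟩-cong eq I

  ⟨⟩-∪⁅⁆ : ∀ {n} (x : Vec Carrier n) I v → v ∉ I → x ⟨ I ∪ ⁅ v ⁆ ⟩ ≈ x ⟨ I ⟩ + lookup x v
  ⟨⟩-∪⁅⁆ (a ∷ x) (inside  ∷ I) zero    v∉I = contradiction here v∉I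
  ⟨⟩-∪⁅⁆ (a ∷ x) (outside ∷ I) zero    v∉I rewrite ∪-identityʳ I = +-comm a _
  ⟨⟩-∪⁅⁆ (a ∷ x) (inside  ∷ I) (suc v) v∉I =
    ≈-trans (+-congˡ (⟨⟩-∪⁅⁆ x I v (v∉I ∘ there))) (≈-sym (+-assoc a _ _))
  ⟨⟩-∪⁅⁆ (a ∷ x) (outside ∷ I) (suc v) v∉I = ⟨⟩-∪⁅⁆ x I v (v∉I ∘ there)

-- Adding one vertex to a subset.

∣∪⁅⁆∣ : ∀ {n} (I : Subset n) v → v ∉ I → ∣ I ∪ ⁅ v ⁆ ∣ ≡ suc ∣ I ∣
∣∪⁅⁆∣ (inside  ∷ I) zero    v∉I = contradiction here v∉I
∣∪⁅⁆∣ (outside ∷ I) zero    v∉I = ≡.cong (suc ∘ ∣_∣) (∪-identityʳ I)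
∣∪⁅⁆∣ (inside  ∷ I) (suc v) v∉I = ≡.cong suc (∣∪⁅⁆∣ I v (v∉I ∘ there))
∣∪⁅⁆∣ (outside ∷ I) (suc v) v∉I = ∣∪⁅⁆∣ I v (v∉I ∘ there)

∈-∪⁅⁆⁻ : ∀ {n} (I : Subset n) {v w} → w ∈ I ∪ ⁅ v ⁆ → w ∈ I ⊎ w ≡ v
∈-∪⁅⁆⁻ I {v} w∈ with x∈p∪q⁻ I ⁅ v ⁆ w∈
... | inj₁ w∈I = inj₁ w∈I
... | inj₂ w∈v = inj₂ (x∈⁅y⁆⇒x≡y v w∈v)

-- Potentials of weighted graphs from shortest paths.

module Feasibility (K : Scalars) (G : IsCompleteOrderedGroup K) where
  open Scalars K
  open IsCompleteOrderedGroup G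
  open GroupSolver K G
  open OrderedGroupProperties K G

  -- For `h false z` = y and `h true z` = x - w, the bounded quantity is s(J) - s(I) - (x(J) - x(I))
  -- with s = y + w. So this is the inequality for (I , J) at x, phrased through upper bounds `c`
  -- because the supremum may be infinite.
  CycleInequality : ∀ {n} {Z : Set} → (Bool → Z → Vec Carrier n) → Set
  CycleInequality {n} {Z} h = ∀ (I J : Subset n) c → ∣ I ∣ ≡ ∣ J ∣ → Empty (I ∩ J) →
    (∀ z → (h false z ⟨ J ⟩ - h true z ⟨ J ⟩) - (h false z ⟨ I ⟩ - h true z ⟨ I ⟩) ≤ c) → 0# ≤ c

  -- Every upper bound counts as a weight, so a pair with unbounded differences has no arc and
  -- infinite weights never occur.
  Arc : ∀ {n} {Z : Set} → (Bool → Z → Vec Carrier n) → Bool → Fin n → Fin n → Carrier → Set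
  Arc h s u v c = ∀ z → lookup (h s z) v - lookup (h s z) u ≤ c

  bounded : ∀ {n} (x : Vec Carrier n) → ∃[ m ] (0# ≤ m × ∀ u → lookup x u ≤ m × 0# - m ≤ lookup x u)
  bounded []      = 0# , ≤-refl , λ ()
  bounded (a ∷ x) with bounded x
  ... | m , 0≤m , bound = M , 0≤M , λ where
      zero    → ≤-trans (x≤x⊔y _ _) (x≤x⊔y _ _)
              , ≤-by (≤-trans (y≤x⊔y a (0# - a)) (x≤x⊔y _ m)) (solve 2 (λ a M → (:0 :- M) :+ M :≈ a :+ (:0 :- a)))
      (suc u) → ≤-trans (proj₁ (bound u)) (y≤x⊔y _ _)
              , ≤-trans (≤-by (y≤x⊔y (a ⊔ (0# - a)) m) (solve 2 (λ m M → (:0 :- M) :+ M :≈ (:0 :- m) :+ m)))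
                        (proj₂ (bound u))
    where
    -- `a ⊔ (0# - a)` serves as the absolute value of `a`.
    M   = (a ⊔ (0# - a)) ⊔ m
    0≤M = ≤-trans 0≤m (y≤x⊔y _ m)

  module _ {n} {Z : Set} (h : Bool → Z → Vec Carrier n) (z₀ : Z) (cycle : CycleInequality h) where

    -- A path ends at the indexed vertex, and the subset holds the vertices before it.
    data Path : Fin n → Subset n → Carrier → Set where
      start : ∀ {v} → Path v ⊥ 0#
      step  : ∀ {u w Q c d} s → Path u Q d → Arc h s u w c → w ∉ Q ∪ ⁅ u ⁆ → Path w (Q ∪ ⁅ u ⁆) (c + d)

    end-fresh : ∀ {u Q d} → Path u Q d → u ∉ Q
    end-fresh start          = ∉⊥
    end-fresh (step _ _ _ w) = w

    -- Arc kinds are read relative to `s₀`, the kind of the arc that will close the cycle.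
    side : Bool → Bool → Bool
    side s₀ false = s₀
    side s₀ true  = not s₀

    relative : ∀ s₀ s → ∃[ r ] side s₀ r ≡ s
    relative false false = false , ≡.refl
    relative false true  = true  , ≡.refl
    relative true  false = true  , ≡.refl
    relative true  true  = false , ≡.refl

    D : Bool → Z → Subset n → Carrier
    D s₀ z I = h s₀ z ⟨ I ⟩ - h (not s₀) z ⟨ I ⟩

    -- J and I collect the vertices where the path switches from arcs of h s₀ to
    -- arcs of h (not s₀), and back; at all other inner vertices the arc bounds
    -- telescope.  r tells whether the last arc is one of h (not s₀).
    record Segment (s₀ : Bool) (v u : Fin n) (r : Bool) (Q : Subset n) (d : Carrier) : Set where
      field
        I J      : Subset n
        bound    : ∀ z → (lookup (h (side s₀ r) z) u - lookup (h s₀ z) v) + (D s₀ z J - D s₀ z I) ≤ d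
        size     : ∣ J ∣ ≡ (if r then suc ∣ I ∣ else ∣ I ∣)
        I⊆Q      : I ⊆ Q
        J⊆Q      : J ⊆ Q
        disjoint : ∀ {w} → w ∈ I → w ∉ J

    -- Taking `r` as `false` treats the future closing arc as the one entering `v`, so that a switch
    -- at `v` itself is recorded too.
    trivialSegment : ∀ s₀ v Q → Segment s₀ v v false Q 0#
    trivialSegment s₀ v Q = record
      { I = ⊥ ; J = ⊥
      ; bound    = λ z → ≤-reflexive (solve 2 (λ a e → (a :- a) :+ (e :- e) :≈ :0))
      ; size     = ≡.refl
      ; I⊆Q      = λ w∈ → contradiction w∈ ∉⊥
      ; J⊆Q      = λ w∈ → contradiction w∈ ∉⊥
      ; disjoint = λ w∈ → contradiction w∈ ∉⊥
      }

    D-∪⁅⁆ : ∀ s₀ z I u → u ∉ I →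
            D s₀ z (I ∪ ⁅ u ⁆) ≈ D s₀ z I + (lookup (h s₀ z) u - lookup (h (not s₀) z) u)
    D-∪⁅⁆ s₀ z I u u∉I = ≈-trans
      (-‿cong₂ (⟨⟩-∪⁅⁆ (h s₀ z) I u u∉I) (⟨⟩-∪⁅⁆ (h (not s₀) z) I u u∉I))
      (solve 4 (λ a b c d → (a :+ b) :- (c :+ d) :≈ (a :- c) :+ (b :- d)))

    -- Without a switch the terms at `u` cancel. With a switch they leave the difference of the two
    -- vectors at `u`, up to sign the increment of `D` when `u` is added to a set: to `J` on leaving
    -- `h s₀`, to `I` on returning.
    extend : ∀ {s₀ v u w r Q c d} r′ → Segment s₀ v u r Q d → u ∉ Q → Arc h (side s₀ r′) u w c →
             Segment s₀ v w r′ (Q ∪ ⁅ u ⁆) (c + d)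
    extend {s₀} {v} {u} {w} {r} {Q} {c} {d} r′ seg u∉Q arc = go r r′ seg arc
      where
      grow : ∀ {A : Subset n} → A ⊆ Q → A ⊆ Q ∪ ⁅ u ⁆
      grow A⊆Q w∈A = p⊆p∪q ⁅ u ⁆ (A⊆Q w∈A)

      insert : ∀ {A} → A ⊆ Q → A ∪ ⁅ u ⁆ ⊆ Q ∪ ⁅ u ⁆
      insert {A} A⊆Q w∈ with ∈-∪⁅⁆⁻ A w∈
      ... | inj₁ w∈A    = grow A⊆Q w∈A
      ... | inj₂ ≡.refl = q⊆p∪q Q ⁅ u ⁆ (x∈⁅x⁆ u)

      go : ∀ r r′ → Segment s₀ v u r Q d → Arc h (side s₀ r′) u w c → Segment s₀ v w r′ (Q ∪ ⁅ u ⁆) (c + d)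
      go r r′ seg arc with r | r′
      ... | false | false = record
        { I = I ; J = J ; size = size ; I⊆Q = grow I⊆Q ; J⊆Q = grow J⊆Q ; disjoint = disjoint
        ; bound = λ z → ≤-by (+-mono-≤ (arc z) (bound z))
            (solve 6 (λ a b e c d x → ((a :- e) :+ x) :+ (c :+ d) :≈ (c :+ d) :+ ((a :- b) :+ ((b :- e) :+ x))))
        } where open Segment seg
      ... | true | true = record
        { I = I ; J = J ; size = size ; I⊆Q = grow I⊆Q ; J⊆Q = grow J⊆Q ; disjoint = disjoint
        ; bound = λ z → ≤-by (+-mono-≤ (arc z) (bound z))
            (solve 6 (λ a b e c d x → ((a :- e) :+ x) :+ (c :+ d) :≈ (c :+ d) :+ ((a :- b) :+ ((b :- e) :+ x))))
        } where open Segment seg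
      ... | false | true = record
        { I = I ; J = J ∪ ⁅ u ⁆ ; I⊆Q = grow I⊆Q ; J⊆Q = insert J⊆Q
        ; size = ≡.trans (∣∪⁅⁆∣ J u (u∉Q ∘ J⊆Q)) (≡.cong suc size)
        ; disjoint = λ w∈I w∈J′ → case ∈-∪⁅⁆⁻ J w∈J′ of λ where
            (inj₁ w∈J)    → disjoint w∈I w∈J
            (inj₂ ≡.refl) → u∉Q (I⊆Q w∈I)
        ; bound = λ z → ≤-respˡ (+-congˡ (-‿cong₂ (≈-sym (D-∪⁅⁆ s₀ z J u (u∉Q ∘ J⊆Q))) ≈-refl))
            (≤-by (+-mono-≤ (arc z) (bound z))
              (solve 8 (λ a b e c d x y f → ((a :- e) :+ ((x :+ (f :- b)) :- y)) :+ (c :+ d)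
                                          :≈ (c :+ d) :+ ((a :- b) :+ ((f :- e) :+ (x :- y))))))
        } where open Segment seg
      ... | true | false = record
        { I = I ∪ ⁅ u ⁆ ; J = J ; I⊆Q = insert I⊆Q ; J⊆Q = grow J⊆Q
        ; size = ≡.trans size (≡.sym (∣∪⁅⁆∣ I u (u∉Q ∘ I⊆Q)))
        ; disjoint = λ w∈I′ w∈J → case ∈-∪⁅⁆⁻ I w∈I′ of λ where
            (inj₁ w∈I)    → disjoint w∈I w∈J
            (inj₂ ≡.refl) → u∉Q (J⊆Q w∈J)
        ; bound = λ z → ≤-respˡ (+-congˡ (-‿cong₂ ≈-refl (≈-sym (D-∪⁅⁆ s₀ z I u (u∉Q ∘ I⊆Q)))))
            (≤-by (+-mono-≤ (arc z) (bound z))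
              (solve 8 (λ a b e c d x y f → ((a :- e) :+ (x :- (y :+ (b :- f)))) :+ (c :+ d)
                                          :≈ (c :+ d) :+ ((a :- b) :+ ((f :- e) :+ (x :- y))))))
        } where open Segment seg

    -- The endpoint terms cancel, which leaves the hypothesis of `cycle`. That hypothesis is
    -- oriented from `false` to `true`, so `I` and `J` trade places when `s₀` is `true`.
    closed-nonNeg : ∀ s₀ {v Q d} → Segment s₀ v v false Q d → 0# ≤ d
    closed-nonNeg false seg =
      cycle I J _ (≡.sym size) (λ (w , w∈) → let w∈I , w∈J = x∈p∩q⁻ I J w∈ in disjoint w∈I w∈J)
        λ z → ≤-by (bound z) (solve 4 (λ a x y d → (x :- y) :+ d :≈ d :+ ((a :- a) :+ (x :- y))))
      where open Segment seg
    closed-nonNeg true seg =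
      cycle J I _ size (λ (w , w∈) → let w∈J , w∈I = x∈p∩q⁻ J I w∈ in disjoint w∈I w∈J)
        λ z → ≤-by (bound z) (solve 6 (λ a x y p q d → ((x :- y) :- (p :- q)) :+ d
                                                     :≈ d :+ ((a :- a) :+ ((q :- p) :- (y :- x)))))
      where open Segment seg

    -- Walks back from the end of the path to the earlier visit of `v`. The segment keeps all of
    -- `Q`, prefix included, as its vertex set, which is enough to see that later vertices are
    -- fresh.
    cut : ∀ s₀ {u v Q d} → Path u Q d → v ∈ Q ∪ ⁅ u ⁆ →
          ∃₂ λ Q′ d₁ → ∃₂ λ r d₂ → Path v Q′ d₁ × Segment s₀ v u r Q d₂ × d₂ + d₁ ≈ d
    cut s₀ {u} {v} {Q} path v∈ with v ≟ u | ∈-∪⁅⁆⁻ Q v∈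
    ... | yes ≡.refl | _          = _ , _ , _ , _ , path , trivialSegment s₀ v Q , +-identityˡ _
    ... | no v≢u     | inj₂ v≡u   = contradiction v≡u v≢u
    ... | no _       | inj₁ v∈Q   with path
    ...   | start                 = contradiction v∈Q ∉⊥
    ...   | step s path′ arc _    with cut s₀ path′ v∈Q | relative s₀ s
    ...     | _ , _ , _ , _ , prefix , seg , eq | r′ , ≡.refl =
      _ , _ , _ , _ , prefix , extend r′ seg (end-fresh path′) arc , ≈-trans (+-assoc _ _ _) (+-congˡ eq)

    -- A weight bounds the difference at every index, in particular at `z₀`, so the coordinates of
    -- two fixed vectors control all arcs from below.
    arc-bound : ∃[ m ] (0# ≤ m × ∀ {s u v c} → Arc h s u v c → 0# - m ≤ c)
    arc-bound with bounded (h false z₀) | bounded (h true z₀)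
    ... | m₁ , 0≤m₁ , b₁ | m₂ , 0≤m₂ , b₂ = (m₁ + m₁) + (m₂ + m₂) , nonNeg , arc≥
      where
      nonNeg : 0# ≤ (m₁ + m₁) + (m₂ + m₂)
      nonNeg = ≤-by (+-mono-≤ (+-mono-≤ 0≤m₁ 0≤m₁) (+-mono-≤ 0≤m₂ 0≤m₂))
        (solve 1 (λ m → :0 :+ m :≈ m :+ ((:0 :+ :0) :+ (:0 :+ :0))))
      arc≥ : ∀ {s u v c} → Arc h s u v c → 0# - ((m₁ + m₁) + (m₂ + m₂)) ≤ c
      arc≥ {false} {u} {v} arc =
        ≤-by (+-mono-≤ (+-mono-≤ (proj₂ (b₁ v)) (proj₁ (b₁ u))) (+-mono-≤ (arc z₀) (+-mono-≤ 0≤m₂ 0≤m₂)))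
          (solve 5 (λ m k a b c → (:0 :- ((m :+ m) :+ (k :+ k))) :+ ((a :+ m) :+ (c :+ (k :+ k)))
                                :≈ c :+ (((:0 :- m) :+ b) :+ ((a :- b) :+ (:0 :+ :0)))))
      arc≥ {true} {u} {v} arc =
        ≤-by (+-mono-≤ (+-mono-≤ (proj₂ (b₂ v)) (proj₁ (b₂ u))) (+-mono-≤ (arc z₀) (+-mono-≤ 0≤m₁ 0≤m₁)))
          (solve 5 (λ m k a b c → (:0 :- ((k :+ k) :+ (m :+ m))) :+ ((a :+ m) :+ (c :+ (k :+ k)))
                                :≈ c :+ (((:0 :- m) :+ b) :+ ((a :- b) :+ (:0 :+ :0)))))

    -- Paths are simple, so the number of vertices bounds the number of arcs. This makes the infimum
    -- of path costs exist.
    path-bound : ∀ k → ∃[ m ] (0# ≤ m × ∀ {v Q d} → Path v Q d → ∣ Q ∣ ℕ.≤ k → 0# - m ≤ d)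
    path-bound zero    = 0# , ≤-refl , λ where
      start                         _ → ≤-reflexive (solve 0 (:0 :- :0 :≈ :0))
      (step {u = u} {Q = Q} _ p _ _) Q≤0 →
        contradiction (≡.subst (ℕ._≤ 0) (∣∪⁅⁆∣ Q u (end-fresh p)) Q≤0) λ ()
    path-bound (suc k) with path-bound k | arc-bound
    ... | m , 0≤m , paths | M , 0≤M , arcs = M + m , 0≤M+m , λ where
        start                          _     → ≤-by 0≤M+m (solve 1 (λ a → (:0 :- a) :+ a :≈ :0 :+ :0))
        (step {u = u} {Q = Q} _ p a _) Q≤1+k →
          ≤-by (+-mono-≤ (arcs a) (paths p (ℕ.s≤s⁻¹ (≡.subst (ℕ._≤ suc k) (∣∪⁅⁆∣ Q u (end-fresh p)) Q≤1+k))))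
            (solve 4 (λ M m c d → (:0 :- (M :+ m)) :+ (c :+ d) :≈ (c :+ d) :+ ((:0 :- M) :+ (:0 :- m))))
      where
      0≤M+m : 0# ≤ M + m
      0≤M+m = ≤-respˡ (+-identityʳ 0#) (+-mono-≤ 0≤M 0≤m)

    -- The value at `v` is the infimum of the costs of all simple paths ending at `v`, over all
    -- starting vertices and admissible weights.
    potential : ∃[ y ] (∀ {s u v c} → Arc h s u v c → lookup y v - lookup y u ≤ c)
    potential = y , λ {s} {u} {v} {c} arc →
      ≡.subst₂ (λ a b → a - b ≤ c) (≡.sym (lookup∘tabulate dist v)) (≡.sym (lookup∘tabulate dist u))
        (≤-by (dist-greatest (relax arc)) (solve 3 (λ a b c → (a :- b) :+ b :≈ c :+ (a :- c))))
      where
      Cost : Fin n → Pred Carrier 0ℓ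
      Cost v d = ∃[ Q ] Path v Q d
      nearest : ∀ v → ∃[ s ] ((∀ d → Cost v d → s ≤ d) × (∀ b → (∀ d → Cost v d → b ≤ d) → b ≤ s))
      -- The empty path makes every vertex a source, so each has a finite distance.
      nearest v = infimum (Cost v) (0# , ⊥ , start)
        (_ , λ d (Q , p) → proj₂ (proj₂ (path-bound n)) p (∣p∣≤n Q))
      dist : Fin n → Carrier
      dist v = proj₁ (nearest v)
      y = tabulate dist
      dist-greatest : ∀ {v b} → (∀ d → Cost v d → b ≤ d) → b ≤ dist v
      dist-greatest {v} = proj₂ (proj₂ (nearest v)) _
      dist-lower : ∀ {v Q d} → Path v Q d → dist v ≤ d
      dist-lower {v} p = proj₁ (proj₂ (nearest v)) _ (_ , p)
      -- If v is already on the path, then the arc closes a cycle, which costs at least 0.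
      relax : ∀ {s u v c} → Arc h s u v c → ∀ d → Cost u d → dist v - c ≤ d
      relax {s} {u} {v} {c} arc d (Q , p) with v ∈? (Q ∪ ⁅ u ⁆)
      ... | no v∉  = ≤-by (dist-lower (step s p arc v∉)) (solve 3 (λ a c d → (a :- c) :+ (c :+ d) :≈ d :+ a))
      ... | yes v∈ with cut s p v∈
      ...   | _ , d₁ , r , d₂ , prefix , seg , d₂+d₁≈d =
        ≤-respʳ d₂+d₁≈d
          (≤-by (+-mono-≤ (dist-lower prefix) (closed-nonNeg s (extend false seg (end-fresh p) arc)))
            (solve 4 (λ a c d₁ d₂ → (a :- c) :+ (d₁ :+ (c :+ d₂)) :≈ (d₂ :+ d₁) :+ (a :+ :0))))

-- Difference bounds determine closed L-convex sets.

module L₂Representation (K : Scalars) (G : IsCompleteOrderedGroup K) (em : ExcludedMiddle 0ℓ) where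
  open Scalars K
  open IsCompleteOrderedGroup G
  open GroupSolver K G
  open OrderedGroupProperties K G
  open Feasibility K G

  -- Topological closedness, tested only by approximation from below; over ℤ
  -- it holds for every set, by ε = 1.
  Closed : ∀ {n} → Pred (Vec Carrier n) 0ℓ → Set
  Closed S = ∀ p →
    (∀ ε → ¬ (ε ≤ 0#) →
      ∃[ q ] (S q × (∀ k → lookup q k ≤ lookup p k) × (∀ k → ¬ (lookup q k + ε ≤ lookup p k)))) →
    S p

  -- The common fold for joins and meets: `Q` survives if both operands have it, `P i` as soon as
  -- one does, so one witness per index yields a witness for all.
  combine : ∀ {V : Set} {m} (_∙_ : V → V → V) (Q : Pred V 0ℓ) (P : Fin m → Pred V 0ℓ) →
            (∀ {r s} → Q r → Q s → Q (r ∙ s)) →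
            (∀ i {r s} → P i r ⊎ P i s → P i (r ∙ s)) →
            ∃ Q → (∀ i → ∃[ r ] (Q r × P i r)) → ∃[ r ] (Q r × ∀ i → P i r)
  combine {m = zero}  _∙_ Q P Q-∙ P-∙ (r , Qr) each = r , Qr , λ ()
  combine {m = suc m} _∙_ Q P Q-∙ P-∙ base each
    with each zero | combine _∙_ Q (P ∘ suc) Q-∙ (P-∙ ∘ suc) base (each ∘ suc)
  ... | s , Qs , Ps | r , Qr , Pr = s ∙ r , Q-∙ Qs Qr , λ where
    zero    → P-∙ zero (inj₁ Ps)
    (suc i) → P-∙ (suc i) (inj₂ (Pr i))

  +-monoʳ-≰ : ∀ {a b c ε} → a ≤ b → ¬ (a + ε ≤ c) → ¬ (b + ε ≤ c)
  +-monoʳ-≰ a≤b a+ε≰c b+ε≤c = a+ε≰c (≤-trans (+-monoˡ-≤ _ a≤b) b+ε≤c)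

  lookup-+𝟏* : ∀ {n} (x : Vec Carrier n) μ i → lookup (x +𝟏* μ) i ≡ lookup x i + μ
  lookup-+𝟏* x μ i = ≡.trans (lookup-zipWith _+_ i x (replicate _ μ)) (≡.cong (lookup x i +_) (lookup-replicate i μ))

  SatisfiesArcBounds : ∀ {n} → Pred (Vec Carrier n) 0ℓ → Pred (Vec Carrier n) 0ℓ
  SatisfiesArcBounds S p = ∀ u v c → (∀ q → S q → lookup q v - lookup q u ≤ c) → lookup p v - lookup p u ≤ c

  module _ {n} {S : Pred (Vec Carrier n) 0ℓ} (convex : IsLConvex S) {p : Vec Carrier n}
           (arcs : SatisfiesArcBounds S p) (ε : Carrier) (ε≰0 : ¬ (ε ≤ 0#)) where

    -- By totality this reads p(k) < q(k) + ε, in the negative form that `Closed` uses.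
    _≺_ : Fin n → Vec Carrier n → Set
    k ≺ q = ¬ (lookup q k + ε ≤ lookup p k)

    -- If no member came within ε of the difference p(v) - p(u), that difference minus ε would bound
    -- the set, and `arcs` would force ε ≤ 0.
    reach : ∀ u v → ∃[ q ] ((S q × lookup q u ≤ lookup p u) × v ≺ q)
    reach u v with em {∃[ q ] (S q × ¬ (lookup q v - lookup q u ≤ (lookup p v - lookup p u) - ε))}
    ... | yes (q , Sq , far) = q +𝟏* μ , (proj₂ (proj₂ convex) q μ Sq , below) , above
      where
      -- The shift makes the member agree with `p` at `u`.
      μ = lookup p u - lookup q u
      below : lookup (q +𝟏* μ) u ≤ lookup p u
      below rewrite lookup-+𝟏* q μ u = ≤-reflexive (solve 2 (λ a b → a :+ (b :- a) :≈ b))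
      above : v ≺ (q +𝟏* μ)
      above rewrite lookup-+𝟏* q μ v = λ le → far (≤-by le
        (solve 5 (λ qv qu pv pu ε → (qv :- qu) :+ pv :≈ ((pv :- pu) :- ε) :+ (qv :+ (pu :- qu) :+ ε))))
    ... | no none = contradiction (≤-by (arcs u v _ near) (solve 2 (λ a ε → ε :+ (a :- ε) :≈ :0 :+ a))) ε≰0
      where
      near : ∀ q → S q → lookup q v - lookup q u ≤ (lookup p v - lookup p u) - ε
      near q Sq with em {lookup q v - lookup q u ≤ (lookup p v - lookup p u) - ε}
      ... | yes le = le
      ... | no ≰   = contradiction (q , Sq , ≰) none

    -- Joining over `v` lifts every coordinate near `p`, while the coordinate at `u` stays below
    -- p(u).
    reachAll : ∀ u → ∃[ q ] ((S q × lookup q u ≤ lookup p u) × ∀ v → v ≺ q)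
    reachAll u = combine _∨_ (λ q → S q × lookup q u ≤ lookup p u) _≺_ closed mono base (reach u)
      where
      base = let q , Q , _ = reach u u in q , Q
      closed : ∀ {r s} → S r × lookup r u ≤ lookup p u → S s × lookup s u ≤ lookup p u →
               S (r ∨ s) × lookup (r ∨ s) u ≤ lookup p u
      closed {r} {s} (Sr , r≤) (Ss , s≤) rewrite lookup-zipWith _⊔_ u r s =
        proj₁ (proj₁ (proj₂ convex) r s Sr Ss) , ⊔-lub r≤ s≤
      mono : ∀ v {r s} → v ≺ r ⊎ v ≺ s → v ≺ (r ∨ s)
      mono v {r} {s} rewrite lookup-zipWith _⊔_ v r s =
        [ +-monoʳ-≰ (x≤x⊔y _ _) , +-monoʳ-≰ (y≤x⊔y _ _) ]′

    -- Meeting over `u` pushes every coordinate below `p`, and nearness survives because all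
    -- operands are near everywhere.
    approximate : ∃[ q ] ((S q × ∀ v → v ≺ q) × ∀ u → lookup q u ≤ lookup p u)
    approximate = combine _∧_ (λ q → S q × ∀ v → v ≺ q) (λ u q → lookup q u ≤ lookup p u) closed mono base
      λ u → let q , (Sq , q≤) , near = reachAll u in q , (Sq , near) , q≤
      where
      base : ∃[ q ] (S q × ∀ v → v ≺ q)
      -- In dimension 0 there is no `u` to start from, but nearness is vacuous.
      base with em {Fin n}
      ... | yes u = let q , (Sq , _) , near = reachAll u in q , Sq , near
      ... | no ¬u = let q , Sq = proj₁ convex in q , Sq , λ v → contradiction v ¬u
      closed : ∀ {r s} → S r × (∀ v → v ≺ r) → S s × (∀ v → v ≺ s) → S (r ∧ s) × ∀ v → v ≺ (r ∧ s)
      closed {r} {s} (Sr , r≻) (Ss , s≻) = proj₂ (proj₁ (proj₂ convex) r s Sr Ss) , near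
        where
        near : ∀ v → v ≺ (r ∧ s)
        near v rewrite lookup-zipWith _⊓_ v r s with ≤-total (lookup r v) (lookup s v)
        ... | inj₁ r≤s = +-monoʳ-≰ (⊓-glb ≤-refl r≤s) (r≻ v)
        ... | inj₂ s≤r = +-monoʳ-≰ (⊓-glb s≤r ≤-refl) (s≻ v)
      mono : ∀ u {r s} → lookup r u ≤ lookup p u ⊎ lookup s u ≤ lookup p u → lookup (r ∧ s) u ≤ lookup p u
      mono u {r} {s} rewrite lookup-zipWith _⊓_ u r s =
        [ ≤-trans (x⊓y≤x _ _) , ≤-trans (x⊓y≤y _ _) ]′

  arcBounds⇒∈ : ∀ {n} {S : Pred (Vec Carrier n) 0ℓ} → IsLConvex S → Closed S → ∀ p → SatisfiesArcBounds S p → S p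
  arcBounds⇒∈ convex closed p arcs = closed p λ ε ε≰0 →
    let q , (Sq , near) , q≤p = approximate convex {p} arcs ε ε≰0 in q , Sq , q≤p , near

  -- The inequalities for a sum of two closed L-convex sets.

  module _ {n} {S S₁ S₂ : Pred (Vec Carrier n) 0ℓ} (convex₁ : IsLConvex S₁) (convex₂ : IsLConvex S₂)
           (closed₁ : Closed S₁) (closed₂ : Closed S₂) (S≐ : S ≐ (S₁ ⊕ S₂)) where

    open AddSupremum _≤_ using (_≤⁺_; [_]; _≤⊤⁺)

    Bound : Subset n → Subset n → Pred Carrier 0ℓ
    Bound I J b = ∀ s → S s → s ⟨ J ⟩ - s ⟨ I ⟩ ≤ b

    member : ∃ S
    member = let (y , S₁y) , _ = convex₁ ; (z , S₂z) , _ = convex₂ in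
      zipWith _+_ y z , proj₂ S≐ (y , z , S₁y , S₂z , Pointwise.refl ≈-refl)

    -- Leastness is tested against finite bounds only, so the value +∞ fits the same statement: in
    -- that case no finite bound exists.
    support : ∀ I J → ∃[ γ ] ((∀ s → S s → [ s ⟨ J ⟩ - s ⟨ I ⟩ ] ≤⁺ γ) ×
                              (∀ {a b} → [ a ] ≤⁺ γ → Bound I J b → a ≤ b))
    support I J with em {∃ (Bound I J)}
    ... | no ¬bounded = ⊤⁺ , (λ _ _ → _ ≤⊤⁺) , λ _ b → contradiction (_ , b) ¬bounded
    ... | yes (b , bound)
      with supremum (λ a → ∃[ s ] (S s × a ≡ s ⟨ J ⟩ - s ⟨ I ⟩))
             (_ , proj₁ member , proj₂ member , ≡.refl) (b , λ where _ (s , Ss , ≡.refl) → bound s Ss)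
    ... | m , upper , least =
      [ m ] , (λ s Ss → [ upper _ (s , Ss , ≡.refl) ])
            , λ where [ a≤m ] bound′ → ≤-trans a≤m (least _ λ where _ (s , Ss , ≡.refl) → bound′ s Ss)

    γ : Subset n → Subset n → Carrier ⁺
    γ I J = proj₁ (support I J)

    -- One index carries a member of each summand, so that the two vectors of `h x` at an index
    -- recombine into an element of `S`.
    Z : Set
    Z = ∃₂ λ y z → S₁ y × S₂ z

    h : Vec Carrier n → Bool → Z → Vec Carrier n
    h x false (y , z , _) = y
    h x true  (y , z , _) = zipWith _-_ x z

    -- A bound `c` for the cycle is the bound c + (x(J) - x(I)) for s(J) - s(I) on `S`. Since γ is
    -- least, x(J) - x(I) lies below it, whence 0 ≤ c.
    cycle : ∀ {x} → Constrained γ x → CycleInequality (h x)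
    cycle {x} x∈ I J c ∣I∣≡∣J∣ I∩J=∅ bound =
      ≤-by (proj₂ (proj₂ (support I J)) (x∈ I J ∣I∣≡∣J∣ I∩J=∅) bound′) (solve 2 (λ c d → :0 :+ (c :+ d) :≈ c :+ d))
      where
      bound′ : Bound I J (c + (x ⟨ J ⟩ - x ⟨ I ⟩))
      bound′ s Ss with proj₁ S≐ Ss
      ... | y , z , S₁y , S₂z , s≈y+z =
        ≤-respˡ (-‿cong₂ (split J) (split I))
          (≤-by (≤-respˡ (-‿cong₂ (-‿cong₂ ≈-refl (⟨⟩-- x z J)) (-‿cong₂ ≈-refl (⟨⟩-- x z I)))
                   (bound (y , z , S₁y , S₂z)))
            (solve 7 (λ yJ zJ xJ yI zI xI c → ((yJ :+ zJ) :- (yI :+ zI)) :+ c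
               :≈ (c :+ (xJ :- xI)) :+ ((yJ :- (xJ :- zJ)) :- (yI :- (xI :- zI))))))
        where
        split : ∀ A → y ⟨ A ⟩ + z ⟨ A ⟩ ≈ s ⟨ A ⟩
        split A = ≈-trans (≈-sym (⟨⟩-+ y z A)) (≈-sym (⟨⟩-cong s≈y+z A))

    z₀ : Z
    z₀ = let (y , S₁y) , _ = convex₁ ; (z , S₂z) , _ = convex₂ in y , z , S₁y , S₂z

    fromPotential : ∀ x → ∃[ y ] (∀ {s u v c} → Arc (h x) s u v c → lookup y v - lookup y u ≤ c) → (S₁ ⊕ S₂) x
    fromPotential x (y , arcs) = y , zipWith _-_ x y , arcBounds⇒∈ convex₁ closed₁ y arcs₁
                           , arcBounds⇒∈ convex₂ closed₂ _ arcs₂ , recompose x y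
      where
      arcs₁ : SatisfiesArcBounds S₁ y
      arcs₁ u v c bound = arcs {false} λ (q , _ , S₁q , _) → bound q S₁q
      arcs₂ : SatisfiesArcBounds S₂ (zipWith _-_ x y)
      arcs₂ u v c bound rewrite lookup-zipWith _-_ u x y | lookup-zipWith _-_ v x y =
        ≤-by (arcs {true} {v} {u} {c + (lookup x u - lookup x v)} reversed)
          (solve 5 (λ xu xv yu yv c → ((xv :- yv) :- (xu :- yu)) :+ (c :+ (xu :- xv)) :≈ c :+ (yu :- yv)))
        where
        -- Passing to x - S₂ changes the sign of differences: a bound for (u , v) becomes an arc
        -- from `v` to `u`, shifted by x(u) - x(v).
        reversed : Arc (h x) true v u (c + (lookup x u - lookup x v))
        reversed (_ , q , _ , S₂q) rewrite lookup-zipWith _-_ u x q | lookup-zipWith _-_ v x q =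
          ≤-by (bound q S₂q)
            (solve 5 (λ xu xv qu qv c → ((xu :- qu) :- (xv :- qv)) :+ c :≈ (c :+ (xu :- xv)) :+ (qv :- qu)))
      recompose : ∀ {m} (x y : Vec Carrier m) → Pointwise _≈_ x (zipWith _+_ y (zipWith _-_ x y))
      recompose []      []      = []
      recompose (a ∷ x) (b ∷ y) = solve 2 (λ a b → a :≈ b :+ (a :- b)) ∷ recompose x y

    representation : ∃[ γ ] (S ≐ Constrained γ)
    representation = γ , (λ Ss I J _ _ → proj₁ (proj₂ (support I J)) _ Ss) , λ {x} x∈ →
      proj₂ S≐ (fromPotential x (potential (h x) z₀ (cycle {x} x∈)))

-- The integers as an instance.

module Integers (em : ExcludedMiddle 0ℓ) where

  IsUpperBound : Pred ℤ 0ℓ → Pred ℤ 0ℓ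
  IsUpperBound A b = ∀ x → A x → x ℤ.≤ b

  -- Descends from the upper bound one unit at a time until excluded middle finds a member of `A`,
  -- at the latest `a` itself.
  supremumWithin : (A : Pred ℤ 0ℓ) → ∀ k {a} → A a → IsUpperBound A (ℤ.+ k ℤ.+ a) →
                   ∃[ s ] (IsUpperBound A s × (∀ b → IsUpperBound A b → s ℤ.≤ b))
  supremumWithin A zero {a} Aa upper =
    a , ≡.subst (IsUpperBound A) (ℤ.+-identityˡ a) upper , λ b upper′ → upper′ a Aa
  supremumWithin A (suc k) {a} Aa upper with em {A (ℤ.+ suc k ℤ.+ a)}
  ... | yes Ab = _ , upper , λ b upper′ → upper′ _ Ab
  ... | no ¬Ab = supremumWithin A k Aa λ x Ax →
    ≡.subst (x ℤ.≤_) (≡.sym (ℤ.pred-+ (ℤ.+ suc k) a))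
      (ℤ.i<j⇒i≤pred[j] (ℤ.≤∧≢⇒< (upper x Ax) λ where ≡.refl → ¬Ab Ax))

  isCompleteOrderedGroup : IsCompleteOrderedGroup ℤ-scalars
  isCompleteOrderedGroup = record
    { negate         = ℤ.-_
    ; isAbelianGroup = ℤ.+-0-isAbelianGroup
    ; x-y≈x+-y       = λ _ _ → ≡.refl
    ; isTotalOrder   = ℤ.≤-isTotalOrder
    ; +-monoˡ-≤      = ℤ.+-monoˡ-≤
    ; x≤x⊔y          = ℤ.i≤i⊔j
    ; y≤x⊔y          = ℤ.i≤j⊔i
    ; ⊔-lub          = ℤ.⊔-lub
    ; x⊓y≤x          = ℤ.i⊓j≤i
    ; x⊓y≤y          = ℤ.i⊓j≤j
    ; ⊓-glb          = ℤ.⊓-glb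
    ; supremum       = λ where
        -- The distance from the member to the bound limits the descent.
        A (a , Aa) (b , upper) → supremumWithin A ℤ.∣ b ℤ.- a ∣ Aa
          (≡.subst (IsUpperBound A) (≡.sym (distance (upper a Aa))) upper)
    }
    where
    distance : ∀ {a b} → a ℤ.≤ b → ℤ.+ ℤ.∣ b ℤ.- a ∣ ℤ.+ a ≡ b
    distance {a} {b} a≤b =
      ≡.trans (≡.cong (ℤ._+ a) (ℤ.0≤i⇒+∣i∣≡i (ℤ.i≤j⇒0≤j-i a≤b)))
        (≡.trans (ℤ.+-assoc b (ℤ.- a) a) (≡.trans (≡.cong (λ c → b ℤ.+ c) (ℤ.+-inverseˡ a)) (ℤ.+-identityʳ b)))

  open L₂Representation ℤ-scalars isCompleteOrderedGroup em using (Closed)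

  -- Between q(k) ≤ p(k) and the failure of q(k) + 1 ≤ p(k) only equality is left.
  closed : ∀ {n} (S : Pred (Vec ℤ n) 0ℓ) → Closed S
  closed S p approx with approx ℤ.1ℤ (λ where (ℤ.+≤+ ()))
  ... | q , Sq , q≤p , near = ≡.subst S q≡p Sq
    where
    agree : ∀ k → lookup q k ≡ lookup p k
    agree k with lookup q k ℤ.≟ lookup p k
    ... | yes eq = eq
    ... | no q≢p = contradiction
      (≡.subst (ℤ._≤ lookup p k) (ℤ.+-comm ℤ.1ℤ (lookup q k)) (ℤ.i<j⇒suc[i]≤j (ℤ.≤∧≢⇒< (q≤p k) q≢p))) (near k)
    q≡p : q ≡ p
    q≡p = ≡.trans (≡.sym (tabulate∘lookup q)) (≡.trans (tabulate-cong agree) (tabulate∘lookup p))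

-- The reals as an instance, and closedness of polyhedra.

module Reals (ℝ : CompleteOrderedField) where
  open CompleteOrderedField ℝ
    using (Carrier; _≈_; _≤_; _+_; _*_; _-_; -_; 0#; 1#; 0≉1; inverse; *-nonNeg
          ; *-identityˡ; distribʳ; *-comm; *-congʳ; *-congˡ; *-assoc)
  private
    module R = CompleteOrderedField ℝ
    module Max = MaxProperties R.totalOrder
    module Min = MinProperties R.totalOrder
  open Algebra.Properties.Ring R.ring using (x[y-z]≈xy-xz; [y-z]x≈yx-zx)

  isCompleteOrderedGroup : IsCompleteOrderedGroup (field-scalars ℝ)
  isCompleteOrderedGroup = record
    { negate         = -_
    ; isAbelianGroup = R.+-isAbelianGroup
    ; x-y≈x+-y       = λ _ _ → R.refl
    ; isTotalOrder   = R.isTotalOrder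
    ; +-monoˡ-≤      = R.+-monoˡ-≤
    ; x≤x⊔y          = Max.x≤x⊔y
    ; y≤x⊔y          = Max.x≤y⊔x
    ; ⊔-lub          = Max.⊔-lub
    ; x⊓y≤x          = Min.x⊓y≤x
    ; x⊓y≤y          = Min.x⊓y≤y
    ; ⊓-glb          = Min.⊓-glb
    ; supremum       = R.supremum
    }

  open IsCompleteOrderedGroup isCompleteOrderedGroup
    using (≈-sym; ≈-trans; +-congˡ; +-congʳ; +-identityʳ; ≤-refl; ≤-reflexive; ≤-total; ≤-antisym)
  open GroupSolver (field-scalars ℝ) isCompleteOrderedGroup
  open OrderedGroupProperties (field-scalars ℝ) isCompleteOrderedGroup
    using (≤-by; +-mono-≤; ≤-respˡ; ≤-respʳ)
  open Real ℝ using (_·_; IsPolyhedron)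

  *-monoˡ-≤ : ∀ {a x y} → 0# ≤ a → x ≤ y → a * x ≤ a * y
  *-monoˡ-≤ {a} {x} {y} 0≤a x≤y =
    ≤-by (≤-respʳ (x[y-z]≈xy-xz a y x) (*-nonNeg 0≤a (≤-by x≤y (solve 2 (λ x y → :0 :+ y :≈ (y :- x) :+ x)))))
      (solve 2 (λ u v → u :+ (v :- u) :≈ v :+ :0))

  *-anti-≤ : ∀ {a x y} → a ≤ 0# → x ≤ y → a * y ≤ a * x
  *-anti-≤ {a} {x} {y} a≤0 x≤y =
    ≤-by (*-monoˡ-≤ {0# - a} (≤-by a≤0 (solve 1 (λ a → :0 :+ :0 :≈ (:0 :- a) :+ a))) x≤y)
      (≈-trans (cancels y) (≈-sym (cancels x)))
    where
    cancels : ∀ z → a * z + (0# - a) * z ≈ 0#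
    cancels z = ≈-trans (+-congˡ ([y-z]x≈yx-zx z 0# a))
      (≈-trans (solve 2 (λ az 0z → az :+ (0z :- az) :≈ 0z)) (R.zeroˡ z))

  0≤1 : 0# ≤ 1#
  0≤1 with ≤-total 0# 1#
  ... | inj₁ 0≤1 = 0≤1
  -- Multiplying 1 ≤ 0 by the nonpositive 1 reverses it.
  ... | inj₂ 1≤0 = ≤-respˡ (R.zeroʳ 1#) (≤-respʳ (*-identityˡ 1#) (*-anti-≤ 1≤0 1≤0))

  -- Adding 1 keeps the divisor invertible when `M` is zero.
  inverse-pos : ∀ {M} → 0# ≤ M → ∃[ i ] (0# ≤ i × (M + 1#) * i ≈ 1#)
  inverse-pos {M} 0≤M with inverse (M + 1#) M+1≉0
    where
    M+1≉0 : ¬ (M + 1# ≈ 0#)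
    M+1≉0 eq = 0≉1 (≤-antisym 0≤1
      (≤-by (+-mono-≤ 0≤M (≤-reflexive eq)) (solve 2 (λ M o → o :+ (M :+ :0) :≈ :0 :+ (:0 :+ (M :+ o))))))
  ... | i , eq with ≤-total 0# i
  ...   | inj₁ 0≤i = i , 0≤i , eq
  ...   | inj₂ i≤0 = contradiction (≤-antisym 0≤1 (≤-respˡ eq (≤-respʳ (R.zeroʳ _) (*-monoˡ-≤ 0≤M+1 i≤0)))) 0≉1
    where
    0≤M+1 : 0# ≤ M + 1#
    0≤M+1 = ≤-respˡ (+-identityʳ 0#) (+-mono-≤ 0≤M 0≤1)

  -- `M` is the sum of the nonnegative coefficients: as q ≤ p, a nonpositive coefficient can only
  -- lower a · p relative to a · q.
  ·-lipschitz : ∀ {n} (a : Vec Carrier n) → ∃[ M ] (0# ≤ M × ∀ p q ε → 0# ≤ ε →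
                (∀ k → lookup q k ≤ lookup p k) → (∀ k → lookup p k ≤ lookup q k + ε) → a · p ≤ a · q + M * ε)
  ·-lipschitz []      = 0# , ≤-refl , λ where
    [] [] ε _ _ _ → ≤-reflexive (≈-trans (solve 0 (:0 :≈ :0 :+ :0)) (+-congˡ (≈-sym (R.zeroˡ ε))))
  ·-lipschitz (a ∷ as) with ·-lipschitz as | ≤-total 0# a
  ... | M , 0≤M , bound | inj₁ 0≤a = a + M , ≤-respˡ (+-identityʳ 0#) (+-mono-≤ 0≤a 0≤M) , λ where
    (p ∷ ps) (q ∷ qs) ε 0≤ε q≤p near →
      ≤-respʳ (≈-trans (+-congʳ (R.distribˡ a q ε))
          (≈-trans (solve 4 (λ x y z w → (x :+ y) :+ (z :+ w) :≈ (x :+ z) :+ (y :+ w))) (+-congˡ (≈-sym (distribʳ ε a M)))))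
        (+-mono-≤ (*-monoˡ-≤ 0≤a (near zero)) (bound ps qs ε 0≤ε (q≤p ∘ suc) (near ∘ suc)))
  ... | M , 0≤M , bound | inj₂ a≤0 = M , 0≤M , λ where
    (p ∷ ps) (q ∷ qs) ε 0≤ε q≤p near →
      ≤-respʳ (solve 3 (λ x z w → x :+ (z :+ w) :≈ (x :+ z) :+ w))
        (+-mono-≤ (*-anti-≤ a≤0 (q≤p zero)) (bound ps qs ε 0≤ε (q≤p ∘ suc) (near ∘ suc)))

  module _ (em : ExcludedMiddle 0ℓ) where
    open L₂Representation (field-scalars ℝ) isCompleteOrderedGroup em using (Closed)

    Approximable : ∀ {n} → Pred (Vec Carrier n) 0ℓ → Pred (Vec Carrier n) 0ℓ
    Approximable S p = ∀ ε → ¬ (ε ≤ 0#) →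
      ∃[ q ] (S q × (∀ k → lookup q k ≤ lookup p k) × (∀ k → ¬ (lookup q k + ε ≤ lookup p k)))

    -- A violation δ > 0 is tested at ε = δ / (M + 1). The approximating point gives δ ≤ M ε, while
    -- δ = M ε + ε, so ε ≤ 0, which is absurd.
    halfspace-closed : ∀ {n} (a : Vec Carrier n) β p → Approximable (λ q → a · q ≤ β) p → a · p ≤ β
    halfspace-closed a β p approx with em {a · p ≤ β}
    ... | yes le = le
    ... | no a·p≰β with ·-lipschitz a
    ...   | M , 0≤M , bound with inverse-pos 0≤M
    ...     | i , 0≤i , eq = contradiction ε≤0 ε≰0
      where
      δ = a · p - β
      ε = δ * i
      0≤δ : 0# ≤ δ
      0≤δ with ≤-total (a · p) β
      ... | inj₁ le = contradiction le a·p≰β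
      ... | inj₂ ge = ≤-by ge (solve 2 (λ x β → :0 :+ x :≈ (x :- β) :+ β))
      Mε+ε≈δ : M * ε + ε ≈ δ
      Mε+ε≈δ = ≈-trans (+-congˡ (≈-sym (*-identityˡ ε))) (≈-trans (≈-sym (distribʳ ε M 1#))
        (≈-trans (*-congˡ (*-comm δ i)) (≈-trans (≈-sym (*-assoc _ i δ)) (≈-trans (*-congʳ eq) (*-identityˡ δ)))))
      0≤ε : 0# ≤ ε
      0≤ε = *-nonNeg 0≤δ 0≤i
      ε≰0 : ¬ (ε ≤ 0#)
      ε≰0 ε≤0 = a·p≰β (≤-by δ≤0 (solve 2 (λ x β → x :+ :0 :≈ β :+ (x :- β))))
        where
        δ≤0 : δ ≤ 0#
        δ≤0 = ≤-respˡ Mε+ε≈δ (≤-respʳ (+-identityʳ 0#)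
          (+-mono-≤ (≤-respʳ (R.zeroʳ M) (*-monoˡ-≤ 0≤M ε≤0)) ε≤0))
      ε≤0 : ε ≤ 0#
      ε≤0 with approx ε ε≰0
      ... | q , a·q≤β , q≤p , near =
        ≤-by (≤-respˡ (≈-sym Mε+ε≈δ) (≤-by (+-mono-≤ (bound p q ε 0≤ε q≤p within) a·q≤β)
                (solve 4 (λ x y β m → (x :- β) :+ ((y :+ m) :+ β) :≈ m :+ (x :+ y)))))
          (solve 2 (λ ε m → ε :+ m :≈ :0 :+ (m :+ ε)))
        where
        within : ∀ k → lookup p k ≤ lookup q k + ε
        within k = [ (λ le → le) , (λ le → contradiction le (near k)) ]′ (≤-total (lookup p k) (lookup q k + ε))

    -- Lets an intersection be treated one halfspace at a time, and the closedness carry over to any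
    -- description of the same set.
    approximable-mono : ∀ {n} {S T : Pred (Vec Carrier n) 0ℓ} {p} → (∀ {q} → S q → T q) →
                        Approximable S p → Approximable T p
    approximable-mono S⊆T approx ε ε≰0 = let q , Sq , rest = approx ε ε≰0 in q , S⊆T Sq , rest

    halfspaces-closed : ∀ {n m} (A : Vec (Vec Carrier n) m) (b : Vec Carrier m) →
                        Closed {n} (λ x → Pointwise _≤_ (map (_· x) A) b)
    halfspaces-closed []      []      p approx = []
    halfspaces-closed (a ∷ A) (β ∷ b) p approx =
      halfspace-closed a β p (approximable-mono {p = p} (λ where (le ∷ _) → le) approx)
      ∷ halfspaces-closed A b p (approximable-mono {p = p} (λ where (_ ∷ les) → les) approx)

    polyhedron-closed : ∀ {n} {P : Pred (Vec Carrier n) 0ℓ} → IsPolyhedron P → Closed P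
    polyhedron-closed (_ , A , b , P⊆ , ⊆P) p approx = ⊆P (halfspaces-closed A b p (approximable-mono {p = p} P⊆ approx))

theorem3p1 : ExcludedMiddle 0ℓ → (n : ℕ) →
    ((S : Pred (Vec ℤ n) 0ℓ) → Integral.IsL₂Convex S →
    ∃ λ (γ : Subset n → Subset n → ℤ ⁺) → S ≐ Integral.Constrained γ)
    ×
    ((ℝ : CompleteOrderedField) → (P : Pred (Vec (CompleteOrderedField.Carrier ℝ) n) 0ℓ) → Real.IsL₂ConvexPolyhedron ℝ P →
    ∃ λ (γ : Subset n → Subset n → CompleteOrderedField.Carrier ℝ ⁺) → P ≐ Real.Constrained ℝ γ)
theorem3p1 em n =
    -- Both cases use the same representation; closedness is automatic over ℤ and comes from the
    -- halfspaces over ℝ.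
    (λ where S (S₁ , S₂ , convex₁ , convex₂ , S≐) →
               L₂Representation.representation ℤ-scalars (Integers.isCompleteOrderedGroup em) em convex₁ convex₂
                 (Integers.closed em S₁) (Integers.closed em S₂) S≐)
  , (λ where ℝ P (_ , P₁ , P₂ , (poly₁ , convex₁) , (poly₂ , convex₂) , P≐) →
               L₂Representation.representation (field-scalars ℝ) (Reals.isCompleteOrderedGroup ℝ) em convex₁ convex₂
                 (Reals.polyhedron-closed ℝ em poly₁) (Reals.polyhedron-closed ℝ em poly₂) P≐)
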